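{- Fix an integer $d\ge 1$ and let $N,M,L\ge 1$ be integers with $N\ge ML$. Let $P\subset[N]^d\times[M]\subset\mathbb{Z}^{d+1}$ be a set of lattice points. Assume that for each $p\in P$ we are given an integer direction vector $s_p=(u_p,1)\in\mathbb{Z}^{d+1}$ with $\|u_p\|_\infty\le L$, such that for all distinct $p,p'\in P$ one has $p'\notin p+\mathbb{R}s_p$ (equivalently, since the last coordinate of $s_p$ is $1$, $p'\notin p+\mathbb{Z}s_p$). Then there exist points $p_1,\dots,p_{|P|}\in[0,1]^{d+1}$ and lines $\ell_1,\dots,\ell_{|P|}$ in $\mathbb{R}^{d+1}$ with $p_i\in\ell_i$ such that for each $i\ne j$, $$d_\infty(p_i,\ell_j)\ \ge\ \frac{1}{2N}.$$
   Context: $[n]=\{1,2,\dots,n\}$. For a point $p$ and a line $\ell$ in $\mathbb{R}^{d+1}$, $d_\infty(p,\ell)=\min_{q\in\ell}\|p-q\|_\infty$, where $\|\cdot\|_\infty$ is the sup norm. -}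

module Defs where

open import Data.Integer.Base as ℤ using (ℤ)
open import Data.Nat.Base as ℕ using (ℕ; suc; NonZero)
import Data.Nat.Properties as ℕ
open import Data.Product.Base using (∃; ∃-syntax; _×_; _,_; proj₁; proj₂)
open import Data.Rational.Base as ℚ using (ℚ; 0ℚ; 1ℚ; ½)
import Data.Rational.Properties as ℚ
open import Data.Rational.Solver using (module +-*-Solver)
open import Data.Sum.Base using (inj₁; inj₂)
open import Data.Vec.Base using (Vec; lookup; init; last)
open import Data.Vec.Functional using (Vector; foldr)
open import Data.Vec.Relation.Unary.All using (All)
open import Relation.Binary.PropositionalEquality

------------------------------------------------------------------------
-- Real numbers: Cauchy sequences of rationals, equal when their
-- difference tends to 0.  The modulus of convergence is carried by the
-- (constructive) existential, so operations can be defined termwise.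

Eventually : (ℕ → Set) → Set
Eventually A = ∃[ k ] (∀ n → k ℕ.≤ n → A n)

IsCauchy : (ℕ → ℚ) → Set
IsCauchy x = ∀ ε → 0ℚ ℚ.< ε →
  ∃[ k ] (∀ m n → k ℕ.≤ m → k ℕ.≤ n → ℚ.∣ x m ℚ.- x n ∣ ℚ.≤ ε)

record ℝ : Set where
  constructor mkℝ
  field
    seq      : ℕ → ℚ
    isCauchy : IsCauchy seq

open ℝ public

infix 4 _≈_ _≤_ _<_

_≈_ : ℝ → ℝ → Set
x ≈ y = ∀ ε → 0ℚ ℚ.< ε → Eventually λ n → ℚ.∣ seq x n ℚ.- seq y n ∣ ℚ.≤ ε

_≤_ : ℝ → ℝ → Set
x ≤ y = ∀ ε → 0ℚ ℚ.< ε → Eventually λ n → seq x n ℚ.≤ seq y n ℚ.+ ε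

_<_ : ℝ → ℝ → Set
x < y = ∃[ ε ] 0ℚ ℚ.< ε × Eventually λ n → seq x n ℚ.+ ε ℚ.≤ seq y n

private
  ∣p-p∣≤ : ∀ p ε → 0ℚ ℚ.< ε → ℚ.∣ p ℚ.- p ∣ ℚ.≤ ε
  ∣p-p∣≤ p ε 0<ε rewrite ℚ.+-inverseʳ p = ℚ.<⇒≤ 0<ε

  halve : ∀ ε → 0ℚ ℚ.< ε → ∃[ η ] 0ℚ ℚ.< η × η ℚ.+ η ≡ ε
  halve ε 0<ε = ½ ℚ.* ε
    , subst (ℚ._< ½ ℚ.* ε) (ℚ.*-zeroʳ ½) (ℚ.*-monoʳ-<-pos ½ 0<ε)
    , trans (sym (ℚ.*-distribʳ-+ ε ½ ½)) (ℚ.*-identityˡ ε)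

  p≤∣p∣ : ∀ p → p ℚ.≤ ℚ.∣ p ∣
  p≤∣p∣ p with ℚ.≤-total 0ℚ p
  ... | inj₁ 0≤p = ℚ.≤-reflexive (sym (ℚ.0≤p⇒∣p∣≡p 0≤p))
  ... | inj₂ p≤0 = ℚ.≤-trans p≤0 (ℚ.0≤∣p∣ p)

  ∣∣-lub : ∀ p {e} → p ℚ.≤ e → ℚ.- p ℚ.≤ e → ℚ.∣ p ∣ ℚ.≤ e
  ∣∣-lub p {e} p≤e -p≤e with ℚ.∣p∣≡p∨∣p∣≡-p p
  ... | inj₁ eq = subst (ℚ._≤ e) (sym eq) p≤e
  ... | inj₂ eq = subst (ℚ._≤ e) (sym eq) -p≤e

  swap-neg : ∀ p q → ℚ.- (p ℚ.- q) ≡ q ℚ.- p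
  swap-neg = solve 2 (λ p q → :- (p :- q) := q :- p) refl
    where open +-*-Solver

  p≡[p-q]+q : ∀ p q → p ≡ (p ℚ.- q) ℚ.+ q
  p≡[p-q]+q = solve 2 (λ p q → p := (p :- q) :+ q) refl
    where open +-*-Solver

  [q+e]-q≡e : ∀ q e → (q ℚ.+ e) ℚ.- q ≡ e
  [q+e]-q≡e = solve 2 (λ q e → (q :+ e) :- q := e) refl
    where open +-*-Solver

  dist⇒≤ : ∀ p q {e} → ℚ.∣ p ℚ.- q ∣ ℚ.≤ e → p ℚ.≤ q ℚ.+ e
  dist⇒≤ p q {e} h = begin
    p                  ≡⟨ p≡[p-q]+q p q ⟩
    (p ℚ.- q) ℚ.+ q    ≤⟨ ℚ.+-monoˡ-≤ q (ℚ.≤-trans (p≤∣p∣ (p ℚ.- q)) h) ⟩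
    e ℚ.+ q            ≡⟨ ℚ.+-comm e q ⟩
    q ℚ.+ e            ∎
    where open ℚ.≤-Reasoning

  ≤⇒- : ∀ p q {e} → p ℚ.≤ q ℚ.+ e → p ℚ.- q ℚ.≤ e
  ≤⇒- p q {e} h =
    subst (p ℚ.- q ℚ.≤_) ([q+e]-q≡e q e) (ℚ.+-monoˡ-≤ (ℚ.- q) h)

  ≤⇒dist : ∀ p q {e} → p ℚ.≤ q ℚ.+ e → q ℚ.≤ p ℚ.+ e → ℚ.∣ p ℚ.- q ∣ ℚ.≤ e
  ≤⇒dist p q {e} h₁ h₂ =
    ∣∣-lub (p ℚ.- q) (≤⇒- p q h₁) (subst (ℚ._≤ e) (sym (swap-neg p q)) (≤⇒- q p h₂))

  +-dist : ∀ a b c d → (a ℚ.+ b) ℚ.- (c ℚ.+ d) ≡ (a ℚ.- c) ℚ.+ (b ℚ.- d)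
  +-dist = solve 4 (λ a b c d → (a :+ b) :- (c :+ d) := (a :- c) :+ (b :- d)) refl
    where open +-*-Solver

  *-dist : ∀ a b c d → a ℚ.* b ℚ.- c ℚ.* d ≡ a ℚ.* (b ℚ.- d) ℚ.+ d ℚ.* (a ℚ.- c)
  *-dist = solve 4
    (λ a b c d → a :* b :- c :* d := a :* (b :- d) :+ d :* (a :- c)) refl
    where open +-*-Solver

  neg-dist : ∀ a b → ℚ.- a ℚ.- ℚ.- b ≡ b ℚ.- a
  neg-dist = solve 2 (λ a b → :- a :- :- b := b :- a) refl
    where open +-*-Solver

  -- Two Cauchy sequences, each evaluated at precisions of our choosing,
  -- beyond a common index.
  Both : ℝ → ℝ → ℚ → ℚ → Set
  Both x y δ₁ δ₂ = ∃[ k ] (∀ m n → k ℕ.≤ m → k ℕ.≤ n →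
    ℚ.∣ seq x m ℚ.- seq x n ∣ ℚ.≤ δ₁ × ℚ.∣ seq y m ℚ.- seq y n ∣ ℚ.≤ δ₂)

  both : ∀ x y δ₁ δ₂ → 0ℚ ℚ.< δ₁ → 0ℚ ℚ.< δ₂ → Both x y δ₁ δ₂
  both x y δ₁ δ₂ 0<δ₁ 0<δ₂ with isCauchy x δ₁ 0<δ₁ | isCauchy y δ₂ 0<δ₂
  ... | k₁ , h₁ | k₂ , h₂ = k₁ ℕ.⊔ k₂ , λ m n m≥ n≥ →
    h₁ m n (ℕ.m⊔n≤o⇒m≤o k₁ k₂ m≥) (ℕ.m⊔n≤o⇒m≤o k₁ k₂ n≥) ,
    h₂ m n (ℕ.m⊔n≤o⇒n≤o k₁ k₂ m≥) (ℕ.m⊔n≤o⇒n≤o k₁ k₂ n≥)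

  +-close : ∀ a b c d {e₁ e₂} → ℚ.∣ a ℚ.- c ∣ ℚ.≤ e₁ → ℚ.∣ b ℚ.- d ∣ ℚ.≤ e₂ →
            ℚ.∣ (a ℚ.+ b) ℚ.- (c ℚ.+ d) ∣ ℚ.≤ e₁ ℚ.+ e₂
  +-close a b c d {e₁} {e₂} h₁ h₂ = begin
    ℚ.∣ (a ℚ.+ b) ℚ.- (c ℚ.+ d) ∣      ≡⟨ cong ℚ.∣_∣ (+-dist a b c d) ⟩
    ℚ.∣ (a ℚ.- c) ℚ.+ (b ℚ.- d) ∣      ≤⟨ ℚ.∣p+q∣≤∣p∣+∣q∣ (a ℚ.- c) (b ℚ.- d) ⟩
    ℚ.∣ a ℚ.- c ∣ ℚ.+ ℚ.∣ b ℚ.- d ∣    ≤⟨ ℚ.+-mono-≤ h₁ h₂ ⟩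
    e₁ ℚ.+ e₂                          ∎
    where open ℚ.≤-Reasoning

  ∣∣-step : ∀ p q {e} → ℚ.∣ p ℚ.- q ∣ ℚ.≤ e → ℚ.∣ p ∣ ℚ.≤ ℚ.∣ q ∣ ℚ.+ e
  ∣∣-step p q {e} h = begin
    ℚ.∣ p ∣                      ≡⟨ cong ℚ.∣_∣ (p≡[p-q]+q p q) ⟩
    ℚ.∣ (p ℚ.- q) ℚ.+ q ∣        ≤⟨ ℚ.∣p+q∣≤∣p∣+∣q∣ (p ℚ.- q) q ⟩
    ℚ.∣ p ℚ.- q ∣ ℚ.+ ℚ.∣ q ∣    ≤⟨ ℚ.+-monoˡ-≤ ℚ.∣ q ∣ h ⟩
    e ℚ.+ ℚ.∣ q ∣                ≡⟨ ℚ.+-comm e ℚ.∣ q ∣ ⟩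
    ℚ.∣ q ∣ ℚ.+ e                ∎
    where open ℚ.≤-Reasoning

  ⊔-step : ∀ a b c d {e} → ℚ.∣ a ℚ.- c ∣ ℚ.≤ e → ℚ.∣ b ℚ.- d ∣ ℚ.≤ e →
           a ℚ.⊔ b ℚ.≤ (c ℚ.⊔ d) ℚ.+ e
  ⊔-step a b c d {e} h₁ h₂ = ℚ.⊔-lub
    (ℚ.≤-trans (dist⇒≤ a c h₁) (ℚ.+-monoˡ-≤ e (ℚ.p≤p⊔q c d)))
    (ℚ.≤-trans (dist⇒≤ b d h₂) (ℚ.+-monoˡ-≤ e (ℚ.p≤q⊔p c d)))

  product-≤ : ∀ a b c d → 0ℚ ℚ.< b → ℚ.∣ a ∣ ℚ.≤ b → ℚ.∣ c ∣ ℚ.≤ d →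
              ℚ.∣ a ℚ.* c ∣ ℚ.≤ b ℚ.* d
  product-≤ a b c d 0<b a≤b c≤d = begin
    ℚ.∣ a ℚ.* c ∣        ≡⟨ ℚ.∣p*q∣≡∣p∣*∣q∣ a c ⟩
    ℚ.∣ a ∣ ℚ.* ℚ.∣ c ∣  ≤⟨ ℚ.*-monoʳ-≤-nonNeg ℚ.∣ c ∣ {{ℚ.∣-∣-nonNeg c}} a≤b ⟩
    b ℚ.* ℚ.∣ c ∣        ≤⟨ ℚ.*-monoˡ-≤-nonNeg b {{ℚ.nonNegative (ℚ.<⇒≤ 0<b)}} c≤d ⟩
    b ℚ.* d              ∎
    where open ℚ.≤-Reasoning

  *-close : ∀ a b c d {A D e₁ e₂} → 0ℚ ℚ.< A → 0ℚ ℚ.< D →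
            ℚ.∣ a ∣ ℚ.≤ A → ℚ.∣ d ∣ ℚ.≤ D →
            ℚ.∣ a ℚ.- c ∣ ℚ.≤ e₁ → ℚ.∣ b ℚ.- d ∣ ℚ.≤ e₂ →
            ℚ.∣ a ℚ.* b ℚ.- c ℚ.* d ∣ ℚ.≤ A ℚ.* e₂ ℚ.+ D ℚ.* e₁
  *-close a b c d {A} {D} {e₁} {e₂} 0<A 0<D a≤A d≤D h₁ h₂ = begin
    ℚ.∣ a ℚ.* b ℚ.- c ℚ.* d ∣
      ≡⟨ cong ℚ.∣_∣ (*-dist a b c d) ⟩
    ℚ.∣ a ℚ.* (b ℚ.- d) ℚ.+ d ℚ.* (a ℚ.- c) ∣
      ≤⟨ ℚ.∣p+q∣≤∣p∣+∣q∣ (a ℚ.* (b ℚ.- d)) (d ℚ.* (a ℚ.- c)) ⟩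
    ℚ.∣ a ℚ.* (b ℚ.- d) ∣ ℚ.+ ℚ.∣ d ℚ.* (a ℚ.- c) ∣
      ≤⟨ ℚ.+-mono-≤ (product-≤ a A (b ℚ.- d) e₂ 0<A a≤A h₂)
                    (product-≤ d D (a ℚ.- c) e₁ 0<D d≤D h₁) ⟩
    A ℚ.* e₂ ℚ.+ D ℚ.* e₁ ∎
    where open ℚ.≤-Reasoning

  scaled : ∀ b η → 0ℚ ℚ.< b → 0ℚ ℚ.< η → ∃[ δ ] 0ℚ ℚ.< δ × b ℚ.* δ ≡ η
  scaled b@record{} η 0<b 0<η = b⁻¹ ℚ.* η
    , subst (ℚ._< b⁻¹ ℚ.* η) (ℚ.*-zeroʳ b⁻¹)
        (ℚ.*-monoʳ-<-pos b⁻¹ {{ℚ.1/pos⇒pos b {{b-pos}}}} 0<η)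
    , trans (sym (ℚ.*-assoc b b⁻¹ η))
        (trans (cong (ℚ._* η) (ℚ.*-inverseʳ b {{b≢0}})) (ℚ.*-identityˡ η))
    where
    b-pos : ℚ.Positive b
    b-pos = ℚ.positive 0<b
    b≢0 : ℚ.NonZero b
    b≢0 = ℚ.pos⇒nonZero b {{b-pos}}
    b⁻¹ : ℚ
    b⁻¹ = (ℚ.1/ b) {{b≢0}}

  0<1 : 0ℚ ℚ.< 1ℚ
  0<1 = ℚ.positive⁻¹ 1ℚ

  bounded : ∀ x → ∃[ b ] 0ℚ ℚ.< b × Eventually λ n → ℚ.∣ seq x n ∣ ℚ.≤ b
  bounded x with isCauchy x 1ℚ 0<1
  ... | k , h = ℚ.∣ seq x k ∣ ℚ.+ 1ℚ
              , ℚ.+-mono-≤-< (ℚ.0≤∣p∣ (seq x k)) 0<1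
              , k , λ n n≥ → ∣∣-step (seq x n) (seq x k) (h n k n≥ ℕ.≤-refl)

  -- Opaque for performance: only the terms of a sequence ever matter.
  opaque
    const-cauchy : ∀ q → IsCauchy (λ _ → q)
    const-cauchy q ε 0<ε = 0 , λ _ _ _ _ → ∣p-p∣≤ q ε 0<ε

    +-cauchy : ∀ x y → IsCauchy (λ n → seq x n ℚ.+ seq y n)
    +-cauchy x y ε 0<ε = go (halve ε 0<ε)
      where
      Goal : Set
      Goal = ∃[ k ] (∀ m n → k ℕ.≤ m → k ℕ.≤ n →
        ℚ.∣ (seq x m ℚ.+ seq y m) ℚ.- (seq x n ℚ.+ seq y n) ∣ ℚ.≤ ε)
      go : (∃[ η ] 0ℚ ℚ.< η × η ℚ.+ η ≡ ε) → Goal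
      go (η , 0<η , refl) = proj₁ xy , λ m n m≥ n≥ →
        +-close (seq x m) (seq y m) (seq x n) (seq y n)
          (proj₁ (proj₂ xy m n m≥ n≥)) (proj₂ (proj₂ xy m n m≥ n≥))
        where
        xy : Both x y η η
        xy = both x y η η 0<η 0<η

    neg-cauchy : ∀ x → IsCauchy (λ n → ℚ.- seq x n)
    neg-cauchy x ε 0<ε with isCauchy x ε 0<ε
    ... | k , h = k , λ m n m≥ n≥ →
      subst (λ z → ℚ.∣ z ∣ ℚ.≤ ε) (sym (neg-dist (seq x m) (seq x n))) (h n m n≥ m≥)

    ∣∣-cauchy : ∀ x → IsCauchy (λ n → ℚ.∣ seq x n ∣)
    ∣∣-cauchy x ε 0<ε with isCauchy x ε 0<ε
    ... | k , h = k , λ m n m≥ n≥ →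
      ≤⇒dist ℚ.∣ seq x m ∣ ℚ.∣ seq x n ∣
        (∣∣-step (seq x m) (seq x n) (h m n m≥ n≥))
        (∣∣-step (seq x n) (seq x m) (h n m n≥ m≥))

    ⊔-cauchy : ∀ x y → IsCauchy (λ n → seq x n ℚ.⊔ seq y n)
    ⊔-cauchy x y ε 0<ε = proj₁ xy , λ m n m≥ n≥ →
      ≤⇒dist (seq x m ℚ.⊔ seq y m) (seq x n ℚ.⊔ seq y n)
        (step m n (proj₂ xy m n m≥ n≥)) (step n m (proj₂ xy n m n≥ m≥))
      where
      xy : Both x y ε ε
      xy = both x y ε ε 0<ε 0<ε
      step : ∀ m n →
        ℚ.∣ seq x m ℚ.- seq x n ∣ ℚ.≤ ε × ℚ.∣ seq y m ℚ.- seq y n ∣ ℚ.≤ ε →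
        seq x m ℚ.⊔ seq y m ℚ.≤ (seq x n ℚ.⊔ seq y n) ℚ.+ ε
      step m n (h₁ , h₂) = ⊔-step (seq x m) (seq y m) (seq x n) (seq y n) h₁ h₂

    *-cauchy : ∀ x y → IsCauchy (λ n → seq x n ℚ.* seq y n)
    *-cauchy x y ε 0<ε = go₁ (halve ε 0<ε) (bounded x) (bounded y)
      where
      Goal : Set
      Goal = ∃[ k ] (∀ m n → k ℕ.≤ m → k ℕ.≤ n →
        ℚ.∣ seq x m ℚ.* seq y m ℚ.- seq x n ℚ.* seq y n ∣ ℚ.≤ ε)

      Bound : ℝ → ℚ → ℕ → Set
      Bound z B k = ∀ n → k ℕ.≤ n → ℚ.∣ seq z n ∣ ℚ.≤ B

      go₃ : ∀ A D e₁ e₂ kx ky → 0ℚ ℚ.< A → 0ℚ ℚ.< D →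
            Bound x A kx → Bound y D ky → A ℚ.* e₂ ℚ.+ D ℚ.* e₁ ≡ ε →
            Both x y e₁ e₂ → Goal
      go₃ A D e₁ e₂ kx ky 0<A 0<D x≤A y≤D eq (k , h) =
        k ℕ.⊔ (kx ℕ.⊔ ky) , λ m n m≥ n≥ →
          subst (ℚ.∣ seq x m ℚ.* seq y m ℚ.- seq x n ℚ.* seq y n ∣ ℚ.≤_) eq
            (close m n (h m n (ℕ.m⊔n≤o⇒m≤o k (kx ℕ.⊔ ky) m≥)
                              (ℕ.m⊔n≤o⇒m≤o k (kx ℕ.⊔ ky) n≥))
              (x≤A m (ℕ.m⊔n≤o⇒m≤o kx ky (ℕ.m⊔n≤o⇒n≤o k (kx ℕ.⊔ ky) m≥)))
              (y≤D n (ℕ.m⊔n≤o⇒n≤o kx ky (ℕ.m⊔n≤o⇒n≤o k (kx ℕ.⊔ ky) n≥))))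
        where
        close : ∀ m n →
          ℚ.∣ seq x m ℚ.- seq x n ∣ ℚ.≤ e₁ × ℚ.∣ seq y m ℚ.- seq y n ∣ ℚ.≤ e₂ →
          ℚ.∣ seq x m ∣ ℚ.≤ A → ℚ.∣ seq y n ∣ ℚ.≤ D →
          ℚ.∣ seq x m ℚ.* seq y m ℚ.- seq x n ℚ.* seq y n ∣ ℚ.≤ A ℚ.* e₂ ℚ.+ D ℚ.* e₁
        close m n (h₁ , h₂) bx by =
          *-close (seq x m) (seq y m) (seq x n) (seq y n) 0<A 0<D bx by h₁ h₂

      go₂ : ∀ η A D kx ky → η ℚ.+ η ≡ ε → 0ℚ ℚ.< A → 0ℚ ℚ.< D →
            Bound x A kx → Bound y D ky →
            (∃[ δ ] 0ℚ ℚ.< δ × A ℚ.* δ ≡ η) → (∃[ δ ] 0ℚ ℚ.< δ × D ℚ.* δ ≡ η) → Goal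
      go₂ η A D kx ky 2η≡ε 0<A 0<D x≤A y≤D (e₂ , 0<e₂ , Ae₂≡η) (e₁ , 0<e₁ , De₁≡η) =
        go₃ A D e₁ e₂ kx ky 0<A 0<D x≤A y≤D
          (trans (cong₂ ℚ._+_ Ae₂≡η De₁≡η) 2η≡ε) (both x y e₁ e₂ 0<e₁ 0<e₂)

      go₁ : (∃[ η ] 0ℚ ℚ.< η × η ℚ.+ η ≡ ε) →
            (∃[ A ] 0ℚ ℚ.< A × ∃ (Bound x A)) → (∃[ D ] 0ℚ ℚ.< D × ∃ (Bound y D)) → Goal
      go₁ (η , 0<η , 2η≡ε) (A , 0<A , kx , x≤A) (D , 0<D , ky , y≤D) =
        go₂ η A D kx ky 2η≡ε 0<A 0<D x≤A y≤D (scaled A η 0<A 0<η) (scaled D η 0<D 0<η)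

infixl 7 _*_
infixl 6 _+_ _-_ _⊔_
infix  8 -_

fromℚ : ℚ → ℝ
fromℚ q = mkℝ (λ _ → q) (const-cauchy q)

fromℤ : ℤ → ℝ
fromℤ i = fromℚ (i ℚ./ 1)

fromℕ : ℕ → ℝ
fromℕ n = fromℤ (ℤ.+ n)

0ℝ 1ℝ : ℝ
0ℝ = fromℚ 0ℚ
1ℝ = fromℚ 1ℚ

_+_ _*_ _⊔_ : ℝ → ℝ → ℝ
x + y = mkℝ (λ n → seq x n ℚ.+ seq y n) (+-cauchy x y)
x * y = mkℝ (λ n → seq x n ℚ.* seq y n) (*-cauchy x y)
x ⊔ y = mkℝ (λ n → seq x n ℚ.⊔ seq y n) (⊔-cauchy x y)

-_ ∣_∣ : ℝ → ℝ
- x   = mkℝ (λ n → ℚ.- seq x n) (neg-cauchy x)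
∣ x ∣ = mkℝ (λ n → ℚ.∣ seq x n ∣) (∣∣-cauchy x)

_-_ : ℝ → ℝ → ℝ
x - y = x + (- y)

1/[2*_] : ∀ N → .{{NonZero N}} → ℝ
1/[2* N ] = fromℚ ((ℤ.+ 1 ℚ./ (2 ℕ.* N)) {{ℕ.m*n≢0 2 N}})

------------------------------------------------------------------------
-- Geometry of ℝⁿ

ℝ^ : ℕ → Set
ℝ^ n = Vector ℝ n

-- Maximum of the absolute values of the coordinates; the base value 0 of
-- the fold is harmless as these are nonnegative.
‖_‖∞ : ∀ {n} → ℝ^ n → ℝ
‖ x ‖∞ = foldr (λ a m → ∣ a ∣ ⊔ m) 0ℝ x

_-ᵛ_ : ∀ {n} → ℝ^ n → ℝ^ n → ℝ^ n
(x -ᵛ y) i = x i - y i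

_∈_+ℝ_ : ∀ {n} → ℝ^ n → ℝ^ n → ℝ^ n → Set
q ∈ p +ℝ v = ∃[ t ] (∀ i → q i ≈ p i + t * v i)

-- Nonzero direction is stated positively, as apartness from 0.
record Line (n : ℕ) : Set where
  field
    base      : ℝ^ n
    direction : ℝ^ n
    nonzero   : ∃[ i ] (0ℝ < ∣ direction i ∣)

_∈ℓ_ : ∀ {n} → ℝ^ n → Line n → Set
q ∈ℓ ℓ = q ∈ Line.base ℓ +ℝ Line.direction ℓ

-- D = min { ‖p − q‖∞ : q ∈ ℓ }, the minimum being attained.
record IsDist∞ {n} (p : ℝ^ n) (ℓ : Line n) (D : ℝ) : Set where
  field
    attained   : ∃[ q ] (q ∈ℓ ℓ × ‖ p -ᵛ q ‖∞ ≈ D)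
    lowerBound : ∀ q → q ∈ℓ ℓ → D ≤ ‖ p -ᵛ q ‖∞

-- The distance d∞(p,ℓ) is at least r.  For arbitrary Cauchy reals the
-- minimum need not be computable, so distance is a relation (it determines
-- D up to ≈) and its existence is part of the assertion.
dist∞_to_≥_ : ∀ {n} → ℝ^ n → Line n → ℝ → Set
dist∞ p to ℓ ≥ r = ∃[ D ] (IsDist∞ p ℓ D × r ≤ D)

InUnitCube : ∀ {n} → ℝ^ n → Set
InUnitCube x = ∀ i → (0ℝ ≤ x i) × (x i ≤ 1ℝ)

------------------------------------------------------------------------
-- Lattice points

⟦_⟧ : ∀ {n} → Vec ℤ n → ℝ^ n
⟦ p ⟧ i = fromℤ (lookup p i)

_∈[1‥_] : ℤ → ℕ → Set
c ∈[1‥ N ] = (ℤ.+ 1 ℤ.≤ c) × (c ℤ.≤ ℤ.+ N)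

-- p ∈ [N]ᵈ × [M], the distinguished coordinate being the last one.
_∈Box[_,_] : ∀ {d} → Vec ℤ (suc d) → ℕ → ℕ → Set
p ∈Box[ N , M ] = All _∈[1‥ N ] (init p) × (last p ∈[1‥ M ])

{-# OPTIONS --safe #-}
module Submission where

-- Scale the first d coordinates by 1/N and the last one by 1/M.  Put p at
-- the origin, let k be the height of p′ over p, and write a point of the line
-- through p as (k + s)(u , 1).  If |s| ≥ M/2N, the last coordinate
-- alone gives distance 1/2N.  Otherwise p′ − k(u , 1) is a nonzero
-- integer vector with last coordinate 0, so some other coordinate is at
-- least 1 in size, while s u has size at most ML/2N ≤ 1/2; after scaling by
-- 1/N the distance is still 1/2N.
--
-- All points and lines are rational, and the distance is attained because
-- minimising maxᵢ |aᵢ − t bᵢ| over t amounts to finding the least m for which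
-- the intervals |aᵢ/bᵢ − t| ≤ m/|bᵢ| have a common point, and intervals
-- with pairwise intersections have one.

open import Defs
open import Data.Nat.Base as ℕ using (ℕ; suc; NonZero)
import Data.Nat.Properties as ℕ
open import Data.Nat.Coprimality as Coprimality using (1-coprimeTo)
open import Data.Integer.Base as ℤ using (ℤ; 1ℤ)
import Data.Integer.Properties as ℤ
open import Data.Fin.Base as Fin using (Fin; zero; suc; inject₁)
open import Data.Fin.Properties using (¬∀⟶∃¬)
open import Data.Fin.Relation.Unary.Top using (view; ‵fromℕ; ‵inject₁)
open import Data.List.Base as List using (List; length)
open import Data.List.Membership.Propositional using (_∈_)
open import Data.List.Membership.Propositional.Properties using (∈-lookup)
open import Data.List.Relation.Unary.Unique.Propositional using (Unique)
open import Data.List.Relation.Unary.AllPairs using (_∷_)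
import Data.List.Relation.Unary.All as All
open import Data.Vec.Base using (Vec; []; _∷_; _∷ʳ_; lookup; init; last; initLast; replicate)
open import Data.Vec.Properties using (lookup-replicate)
open import Data.Vec.Relation.Unary.All.Properties using (lookup⁺)
open import Data.Product.Base using (∃-syntax; Σ-syntax; _×_; _,_; proj₁; proj₂)
open import Data.Rational.Base as ℚ using (ℚ; 0ℚ; 1ℚ; mkℚ)
import Data.Rational.Properties as ℚ
open import Data.Rational.Solver using (module +-*-Solver)
open import Data.Sum.Base using (_⊎_; inj₁; inj₂)
open import Function.Base using (_∘_)
open import Relation.Nullary using (yes; no; contradiction)
open import Relation.Nullary.Negation using (¬_)
open import Relation.Binary.PropositionalEquality

open +-*-Solver using (solve; _:+_; _:*_; _:-_; :-_; _:=_)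

-- Rational arithmetic

∣p∣≤e : ∀ p {e} → p ℚ.≤ e → ℚ.- p ℚ.≤ e → ℚ.∣ p ∣ ℚ.≤ e
∣p∣≤e p {e} p≤e -p≤e with ℚ.∣p∣≡p∨∣p∣≡-p p
... | inj₁ eq = subst (ℚ._≤ e) (sym eq) p≤e
... | inj₂ eq = subst (ℚ._≤ e) (sym eq) -p≤e

p≤∣p∣ : ∀ p → p ℚ.≤ ℚ.∣ p ∣
p≤∣p∣ p with ℚ.≤-total 0ℚ p
... | inj₁ 0≤p = ℚ.≤-reflexive (sym (ℚ.0≤p⇒∣p∣≡p 0≤p))
... | inj₂ p≤0 = ℚ.≤-trans p≤0 (ℚ.0≤∣p∣ p)

∣p-q∣≡∣q-p∣ : ∀ p q → ℚ.∣ p ℚ.- q ∣ ≡ ℚ.∣ q ℚ.- p ∣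
∣p-q∣≡∣q-p∣ p q = trans (sym (ℚ.∣-p∣≡∣p∣ (p ℚ.- q)))
  (cong ℚ.∣_∣ (solve 2 (λ p q → :- (p :- q) := q :- p) refl p q))

p-q≤e⇒p≤q+e : ∀ p q {e} → p ℚ.- q ℚ.≤ e → p ℚ.≤ q ℚ.+ e
p-q≤e⇒p≤q+e p q {e} h = subst (ℚ._≤ q ℚ.+ e)
  (solve 2 (λ p q → q :+ (p :- q) := p) refl p q) (ℚ.+-monoʳ-≤ q h)

p≤q+e⇒p-q≤e : ∀ p q {e} → p ℚ.≤ q ℚ.+ e → p ℚ.- q ℚ.≤ e
p≤q+e⇒p-q≤e p q {e} h = subst (p ℚ.- q ℚ.≤_)
  (solve 2 (λ q e → (q :+ e) :- q := e) refl q e) (ℚ.+-monoˡ-≤ (ℚ.- q) h)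

triangle : ∀ p q r → ℚ.∣ p ℚ.- r ∣ ℚ.≤ ℚ.∣ p ℚ.- q ∣ ℚ.+ ℚ.∣ q ℚ.- r ∣
triangle p q r = subst (λ z → ℚ.∣ z ∣ ℚ.≤ ℚ.∣ p ℚ.- q ∣ ℚ.+ ℚ.∣ q ℚ.- r ∣)
  (solve 3 (λ p q r → (p :- q) :+ (q :- r) := p :- r) refl p q r)
  (ℚ.∣p+q∣≤∣p∣+∣q∣ (p ℚ.- q) (q ℚ.- r))

*-monoˡ-≤ : ∀ {p q r} → 0ℚ ℚ.≤ r → p ℚ.≤ q → r ℚ.* p ℚ.≤ r ℚ.* q
*-monoˡ-≤ {r = r} 0≤r = ℚ.*-monoˡ-≤-nonNeg r {{ℚ.nonNegative 0≤r}}

*-monoʳ-≤ : ∀ {p q r} → 0ℚ ℚ.≤ r → p ℚ.≤ q → p ℚ.* r ℚ.≤ q ℚ.* r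
*-monoʳ-≤ {r = r} 0≤r = ℚ.*-monoʳ-≤-nonNeg r {{ℚ.nonNegative 0≤r}}

reciprocal : ∀ p → p ≢ 0ℚ → ∃[ q ] p ℚ.* q ≡ 1ℚ
reciprocal p p≢0 = (ℚ.1/ p) {{p-nz}} , ℚ.*-inverseʳ p {{p-nz}}
  where p-nz = ℚ.≢-nonZero p≢0

pos-reciprocal : ∀ p → 0ℚ ℚ.< p → ∃[ q ] 0ℚ ℚ.≤ q × p ℚ.* q ≡ 1ℚ
pos-reciprocal p 0<p =
  (ℚ.1/ p) {{p-nz}} ,
  ℚ.<⇒≤ (ℚ.positive⁻¹ _ {{ℚ.1/pos⇒pos p {{p-pos}}}}) ,
  ℚ.*-inverseʳ p {{p-nz}}
  where
  p-pos = ℚ.positive 0<p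
  p-nz  = ℚ.pos⇒nonZero p {{p-pos}}

-- By density: if `q < p`, take `m` strictly between them; the hypothesis at `ε = m - q` gives
-- `p ≤ m`. This turns `≤` between constant reals back into `≤` of rationals.
≤-approx : ∀ {p q} → (∀ ε → 0ℚ ℚ.< ε → p ℚ.≤ q ℚ.+ ε) → p ℚ.≤ q
≤-approx {p} {q} h = ℚ.≮⇒≥ λ q<p →
  let m , q<m , m<p = ℚ.<-dense q<p
      0<m-q = subst (ℚ._< m ℚ.- q) (ℚ.+-inverseʳ q) (ℚ.+-monoˡ-< (ℚ.- q) q<m)
      p≤m   = subst (p ℚ.≤_) (solve 2 (λ m q → q :+ (m :- q) := m) refl m q)
                (h (m ℚ.- q) 0<m-q)
  in ℚ.<-irrefl refl (ℚ.≤-<-trans p≤m m<p)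

supremum : ∀ {n} (f : Fin (suc n) → ℚ) →
  ∃[ s ] (∀ i → f i ℚ.≤ s) × (∀ m → (∀ i → f i ℚ.≤ m) → s ℚ.≤ m)
supremum {ℕ.zero} f = f zero , (λ { zero → ℚ.≤-refl }) , λ _ h → h zero
supremum {suc n} f with supremum (f ∘ suc)
... | s , upper , least =
  f zero ℚ.⊔ s ,
  (λ { zero    → ℚ.p≤p⊔q (f zero) s
     ; (suc i) → ℚ.≤-trans (upper i) (ℚ.p≤q⊔p (f zero) s) }) ,
  λ m h → ℚ.⊔-lub (h zero) (least m (h ∘ suc))

-- Minimising a maximum of absolute values of affine functions

-- Helly's theorem on the line. With `D` the least scale at which all pairs of intervals meet, the
-- largest left endpoint at scale `D` lies in every interval, and any feasible `m` is at least `D`.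
-- Since `t₀` is chosen before `t` and `m`, it is optimal against all of them.
intervals-helly : ∀ {n} (c ρ : Fin (suc n) → ℚ) → (∀ i → 0ℚ ℚ.< ρ i) →
  ∃[ t₀ ] (∀ t m → (∀ i → ℚ.∣ c i ℚ.- t ∣ ℚ.≤ m ℚ.* ρ i) →
                    ∀ i → ℚ.∣ c i ℚ.- t₀ ∣ ℚ.≤ m ℚ.* ρ i)
intervals-helly {n} c ρ 0<ρ = t₀ , optimal
  where
  open ℚ.≤-Reasoning

  σ-spec : ∀ i j → ∃[ σ ] 0ℚ ℚ.≤ σ × (ρ i ℚ.+ ρ j) ℚ.* σ ≡ 1ℚ
  σ-spec i j = pos-reciprocal (ρ i ℚ.+ ρ j) (ℚ.+-mono-< (0<ρ i) (0<ρ j))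

  σ : Fin (suc n) → Fin (suc n) → ℚ
  σ i j = proj₁ (σ-spec i j)

  0≤σ : ∀ i j → 0ℚ ℚ.≤ σ i j
  0≤σ i j = proj₁ (proj₂ (σ-spec i j))

  σ-inv : ∀ i j → (ρ i ℚ.+ ρ j) ℚ.* σ i j ≡ 1ℚ
  σ-inv i j = proj₂ (proj₂ (σ-spec i j))

  -- The least m for which the i-th and the j-th interval meet.
  meet : Fin (suc n) → Fin (suc n) → ℚ
  meet i j = (c i ℚ.- c j) ℚ.* σ i j

  meet-sup : ∀ i → ∃[ s ] (∀ j → meet i j ℚ.≤ s) × (∀ m → (∀ j → meet i j ℚ.≤ m) → s ℚ.≤ m)
  meet-sup i = supremum (meet i)

  -- All ordered pairs enter, so `meet i j` and `meet j i` together account for the absolute value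
  -- of the difference of centres.
  D-sup : ∃[ s ] (∀ i → proj₁ (meet-sup i) ℚ.≤ s) ×
                 (∀ m → (∀ i → proj₁ (meet-sup i) ℚ.≤ m) → s ℚ.≤ m)
  D-sup = supremum (proj₁ ∘ meet-sup)

  D : ℚ
  D = proj₁ D-sup

  meet≤D : ∀ i j → meet i j ℚ.≤ D
  meet≤D i j = ℚ.≤-trans (proj₁ (proj₂ (meet-sup i)) j) (proj₁ (proj₂ D-sup) i)

  D-least : ∀ m → (∀ i j → meet i j ℚ.≤ m) → D ℚ.≤ m
  D-least m h = proj₂ (proj₂ D-sup) m λ i → proj₂ (proj₂ (meet-sup i)) m (h i)

  -- The rightmost left endpoint at scale `D`; by `lower≤upper` it does not exceed any right
  -- endpoint.
  t₀-sup : ∃[ s ] (∀ i → c i ℚ.- D ℚ.* ρ i ℚ.≤ s) ×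
                  (∀ m → (∀ i → c i ℚ.- D ℚ.* ρ i ℚ.≤ m) → s ℚ.≤ m)
  t₀-sup = supremum λ i → c i ℚ.- D ℚ.* ρ i

  t₀ : ℚ
  t₀ = proj₁ t₀-sup

  lower≤upper : ∀ i j → c i ℚ.- D ℚ.* ρ i ℚ.≤ c j ℚ.+ D ℚ.* ρ j
  lower≤upper i j = begin
    c i ℚ.- D ℚ.* ρ i
      ≡⟨ solve 3 (λ x y z → x :- z := y :+ ((x :- y) :- z)) refl (c i) (c j) (D ℚ.* ρ i) ⟩
    c j ℚ.+ ((c i ℚ.- c j) ℚ.- D ℚ.* ρ i)
      ≤⟨ ℚ.+-monoʳ-≤ (c j) (p≤q+e⇒p-q≤e (c i ℚ.- c j) (D ℚ.* ρ i) gap) ⟩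
    c j ℚ.+ D ℚ.* ρ j ∎
    where
    gap : c i ℚ.- c j ℚ.≤ D ℚ.* ρ i ℚ.+ D ℚ.* ρ j
    gap = begin
      c i ℚ.- c j
        ≡⟨ ℚ.*-identityʳ _ ⟨
      (c i ℚ.- c j) ℚ.* 1ℚ
        ≡⟨ cong ((c i ℚ.- c j) ℚ.*_) (σ-inv i j) ⟨
      (c i ℚ.- c j) ℚ.* ((ρ i ℚ.+ ρ j) ℚ.* σ i j)
        ≡⟨ solve 3 (λ x y z → x :* (y :* z) := (x :* z) :* y) refl
             (c i ℚ.- c j) (ρ i ℚ.+ ρ j) (σ i j) ⟩
      meet i j ℚ.* (ρ i ℚ.+ ρ j)
        ≤⟨ *-monoʳ-≤ (ℚ.<⇒≤ (ℚ.+-mono-< (0<ρ i) (0<ρ j))) (meet≤D i j) ⟩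
      D ℚ.* (ρ i ℚ.+ ρ j)
        ≡⟨ ℚ.*-distribˡ-+ D (ρ i) (ρ j) ⟩
      D ℚ.* ρ i ℚ.+ D ℚ.* ρ j ∎

  t₀-inside : ∀ i → ℚ.∣ c i ℚ.- t₀ ∣ ℚ.≤ D ℚ.* ρ i
  t₀-inside i = ∣p∣≤e (c i ℚ.- t₀)
    (p≤q+e⇒p-q≤e (c i) t₀ (subst (c i ℚ.≤_) (ℚ.+-comm (D ℚ.* ρ i) t₀)
      (p-q≤e⇒p≤q+e (c i) (D ℚ.* ρ i) (proj₁ (proj₂ t₀-sup) i))))
    (subst (ℚ._≤ D ℚ.* ρ i) (solve 2 (λ x t → t :- x := :- (x :- t)) refl (c i) t₀)
      (p≤q+e⇒p-q≤e t₀ (c i) (proj₂ (proj₂ t₀-sup) _ λ j → lower≤upper j i)))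

  optimal : ∀ t m → (∀ i → ℚ.∣ c i ℚ.- t ∣ ℚ.≤ m ℚ.* ρ i) →
            ∀ i → ℚ.∣ c i ℚ.- t₀ ∣ ℚ.≤ m ℚ.* ρ i
  optimal t m h i = ℚ.≤-trans (t₀-inside i) (*-monoʳ-≤ (ℚ.<⇒≤ (0<ρ i)) (D-least m meet≤m))
    where
    -- The triangle inequality through the common point `t` bounds the distance of the centres by
    -- the sum of the radii.
    meet≤m : ∀ i j → meet i j ℚ.≤ m
    meet≤m i j = begin
      (c i ℚ.- c j) ℚ.* σ i j
        ≤⟨ *-monoʳ-≤ (0≤σ i j) (ℚ.≤-trans (p≤∣p∣ _) (triangle (c i) t (c j))) ⟩
      (ℚ.∣ c i ℚ.- t ∣ ℚ.+ ℚ.∣ t ℚ.- c j ∣) ℚ.* σ i j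
        ≤⟨ *-monoʳ-≤ (0≤σ i j) (ℚ.+-mono-≤ (h i)
             (subst (ℚ._≤ m ℚ.* ρ j) (∣p-q∣≡∣q-p∣ (c j) t) (h j))) ⟩
      (m ℚ.* ρ i ℚ.+ m ℚ.* ρ j) ℚ.* σ i j
        ≡⟨ solve 4 (λ m x y z → (m :* x :+ m :* y) :* z := m :* ((x :+ y) :* z)) refl
             m (ρ i) (ρ j) (σ i j) ⟩
      m ℚ.* ((ρ i ℚ.+ ρ j) ℚ.* σ i j)
        ≡⟨ cong (m ℚ.*_) (σ-inv i j) ⟩
      m ℚ.* 1ℚ
        ≡⟨ ℚ.*-identityʳ m ⟩
      m ∎

-- Dividing by `b i` turns each constraint into an interval around `a i / b i` whose radius is
-- proportional to `1 / ∣b i∣`, so that `intervals-helly` applies.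
minimiser : ∀ {n} (a b : Fin (suc n) → ℚ) → ∃[ k ] b k ≢ 0ℚ →
  ∃[ t₀ ] (∀ t m → (∀ i → ℚ.∣ a i ℚ.- t ℚ.* b i ∣ ℚ.≤ m) →
                    ∀ i → ℚ.∣ a i ℚ.- t₀ ℚ.* b i ∣ ℚ.≤ m)
minimiser {n} a b (k , bk≢0) = t₀ , optimal
  where
  open ℚ.≤-Reasoning

  -- The indices with b i ≡ 0 do not constrain t and are redirected to k.
  π-spec : ∀ i → ∃[ j ] b j ≢ 0ℚ × (j ≡ i ⊎ b i ≡ 0ℚ)
  π-spec i with b i ℚ.≟ 0ℚ
  ... | yes bi≡0 = k , bk≢0 , inj₂ bi≡0
  ... | no  bi≢0 = i , bi≢0 , inj₁ refl

  π : Fin (suc n) → Fin (suc n)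
  π i = proj₁ (π-spec i)

  β : Fin (suc n) → ℚ
  β i = proj₁ (reciprocal (b (π i)) (proj₁ (proj₂ (π-spec i))))

  bβ≡1 : ∀ i → b (π i) ℚ.* β i ≡ 1ℚ
  bβ≡1 i = proj₂ (reciprocal (b (π i)) (proj₁ (proj₂ (π-spec i))))

  ∣β∣∣b∣≡1 : ∀ i → ℚ.∣ β i ∣ ℚ.* ℚ.∣ b (π i) ∣ ≡ 1ℚ
  ∣β∣∣b∣≡1 i = trans (sym (ℚ.∣p*q∣≡∣p∣*∣q∣ (β i) (b (π i))))
    (cong ℚ.∣_∣ (trans (ℚ.*-comm (β i) (b (π i))) (bβ≡1 i)))

  0<∣β∣ : ∀ i → 0ℚ ℚ.< ℚ.∣ β i ∣
  0<∣β∣ i = ℚ.≰⇒> λ ∣β∣≤0 → contradiction (trans (sym (∣β∣∣b∣≡1 i))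
    (trans (cong (ℚ._* ℚ.∣ b (π i) ∣) (ℚ.≤-antisym ∣β∣≤0 (ℚ.0≤∣p∣ (β i))))
      (ℚ.*-zeroˡ ℚ.∣ b (π i) ∣))) λ ()

  helly : ∃[ t₀ ] (∀ t m → (∀ i → ℚ.∣ a (π i) ℚ.* β i ℚ.- t ∣ ℚ.≤ m ℚ.* ℚ.∣ β i ∣) →
                           ∀ i → ℚ.∣ a (π i) ℚ.* β i ℚ.- t₀ ∣ ℚ.≤ m ℚ.* ℚ.∣ β i ∣)
  helly = intervals-helly (λ i → a (π i) ℚ.* β i) (λ i → ℚ.∣ β i ∣) 0<∣β∣

  t₀ : ℚ
  t₀ = proj₁ helly

  normalise : ∀ i t → a (π i) ℚ.* β i ℚ.- t ≡ (a (π i) ℚ.- t ℚ.* b (π i)) ℚ.* β i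
  normalise i t = begin-equality
    a (π i) ℚ.* β i ℚ.- t
      ≡⟨ cong (λ z → a (π i) ℚ.* β i ℚ.- z) (ℚ.*-identityʳ t) ⟨
    a (π i) ℚ.* β i ℚ.- t ℚ.* 1ℚ
      ≡⟨ cong (λ z → a (π i) ℚ.* β i ℚ.- t ℚ.* z) (bβ≡1 i) ⟨
    a (π i) ℚ.* β i ℚ.- t ℚ.* (b (π i) ℚ.* β i)
      ≡⟨ solve 4 (λ a b β t → a :* β :- t :* (b :* β) := (a :- t :* b) :* β) refl
           (a (π i)) (b (π i)) (β i) t ⟩
    (a (π i) ℚ.- t ℚ.* b (π i)) ℚ.* β i ∎

  ∣normalise∣ : ∀ i t → ℚ.∣ a (π i) ℚ.* β i ℚ.- t ∣ ≡
                        ℚ.∣ a (π i) ℚ.- t ℚ.* b (π i) ∣ ℚ.* ℚ.∣ β i ∣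
  ∣normalise∣ i t = trans (cong ℚ.∣_∣ (normalise i t)) (ℚ.∣p*q∣≡∣p∣*∣q∣ (a (π i) ℚ.- t ℚ.* b (π i)) (β i))

  optimal-π : ∀ t m → (∀ i → ℚ.∣ a i ℚ.- t ℚ.* b i ∣ ℚ.≤ m) →
              ∀ i → ℚ.∣ a (π i) ℚ.- t₀ ℚ.* b (π i) ∣ ℚ.≤ m
  optimal-π t m h i = ℚ.*-cancelʳ-≤-pos ℚ.∣ β i ∣ {{ℚ.positive (0<∣β∣ i)}}
    (subst (ℚ._≤ m ℚ.* ℚ.∣ β i ∣) (∣normalise∣ i t₀)
      (proj₂ helly t m
        (λ j → subst (ℚ._≤ m ℚ.* ℚ.∣ β j ∣) (sym (∣normalise∣ j t))
                 (*-monoʳ-≤ (ℚ.0≤∣p∣ (β j)) (h (π j))))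
        i))

  optimal : ∀ t m → (∀ i → ℚ.∣ a i ℚ.- t ℚ.* b i ∣ ℚ.≤ m) →
            ∀ i → ℚ.∣ a i ℚ.- t₀ ℚ.* b i ∣ ℚ.≤ m
  optimal t m h i with proj₂ (proj₂ (π-spec i))
  ... | inj₁ πi≡i = subst (λ j → ℚ.∣ a j ℚ.- t₀ ℚ.* b j ∣ ℚ.≤ m) πi≡i (optimal-π t m h i)
  -- For `b i ≡ 0` the expression is the same at `t` and at `t₀`.
  ... | inj₂ bi≡0 = subst (ℚ._≤ m) (cong (λ z → ℚ.∣ a i ℚ.- z ∣) (trans (tb≡0 t) (sym (tb≡0 t₀)))) (h i)
    where
    tb≡0 : ∀ t → t ℚ.* b i ≡ 0ℚ
    tb≡0 t = trans (cong (t ℚ.*_) bi≡0) (ℚ.*-zeroʳ t)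

-- The sup norm and the distance to rational lines

-- The norm is a fold of termwise operations, so the bound holds at every index `k`, not only in the
-- limit.
∣xᵢ∣≤‖x‖∞ : ∀ {n} (x : ℝ^ n) i k → ℚ.∣ seq (x i) k ∣ ℚ.≤ seq ‖ x ‖∞ k
∣xᵢ∣≤‖x‖∞ x zero    k = ℚ.p≤p⊔q _ _
∣xᵢ∣≤‖x‖∞ x (suc i) k = ℚ.≤-trans (∣xᵢ∣≤‖x‖∞ (x ∘ suc) i k) (ℚ.p≤q⊔p ℚ.∣ seq (x zero) k ∣ _)

-- The condition `0 ≤ m` covers the base value 0 of the fold.
‖x‖∞≤ : ∀ {n} (x : ℝ^ n) k {m} → 0ℚ ℚ.≤ m → (∀ i → ℚ.∣ seq (x i) k ∣ ℚ.≤ m) → seq ‖ x ‖∞ k ℚ.≤ m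
‖x‖∞≤ {ℕ.zero} x k 0≤m h = 0≤m
‖x‖∞≤ {suc n}  x k 0≤m h = ℚ.⊔-lub (h zero) (‖x‖∞≤ (x ∘ suc) k 0≤m (h ∘ suc))

≈-refl : ∀ x → x ≈ x
≈-refl x ε 0<ε = 0 , λ n _ → subst (λ z → ℚ.∣ z ∣ ℚ.≤ ε) (sym (ℚ.+-inverseʳ (seq x n))) (ℚ.<⇒≤ 0<ε)

eventually-∀ : ∀ {n} {A : Fin n → ℕ → Set} → (∀ i → Eventually (A i)) → Eventually λ k → ∀ i → A i k
eventually-∀ {ℕ.zero} h = 0 , λ _ _ ()
eventually-∀ {suc n} h with h zero | eventually-∀ (h ∘ suc)
... | k₁ , h₁ | k₂ , h₂ = k₁ ℕ.⊔ k₂ , λ n n≥ →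
  λ { zero    → h₁ n (ℕ.m⊔n≤o⇒m≤o k₁ k₂ n≥)
    ; (suc i) → h₂ n (ℕ.m⊔n≤o⇒n≤o k₁ k₂ n≥) i }

-- A rational minimiser `t₀` gives a nearest point whose distance `D` is a constant sequence. It
-- also beats the real points of the line, because each term of a real parameter is rational. The
-- bound `r` then only has to be checked at `t₀`.
dist-to-rational-line : ∀ {n} (x : Fin (suc n) → ℚ) (ℓ : Line (suc n)) (y v : Fin (suc n) → ℚ) →
  Line.base ℓ ≡ fromℚ ∘ y → Line.direction ℓ ≡ fromℚ ∘ v → ∃[ k ] v k ≢ 0ℚ →
  (r : ℚ) → (∀ t → ∃[ i ] r ℚ.≤ ℚ.∣ x i ℚ.- (y i ℚ.+ t ℚ.* v i) ∣) →
  dist∞ (fromℚ ∘ x) to ℓ ≥ fromℚ r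
dist-to-rational-line {n} x ℓ y v refl refl v≢0 r far =
  D , record { attained = q₀ , (fromℚ t₀ , λ i → ≈-refl (q₀ i)) , ≈-refl D
             ; lowerBound = lower } , r≤D
  where
  open ℚ.≤-Reasoning

  min : ∃[ t₀ ] (∀ t m → (∀ i → ℚ.∣ (x i ℚ.- y i) ℚ.- t ℚ.* v i ∣ ℚ.≤ m) →
                          ∀ i → ℚ.∣ (x i ℚ.- y i) ℚ.- t₀ ℚ.* v i ∣ ℚ.≤ m)
  min = minimiser (λ i → x i ℚ.- y i) v v≢0

  t₀ : ℚ
  t₀ = proj₁ min

  q₀ : ℝ^ (suc n)
  q₀ i = fromℚ (y i) + fromℚ t₀ * fromℚ (v i)

  D : ℝ
  D = ‖ (fromℚ ∘ x) -ᵛ q₀ ‖∞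

  r≤D : fromℚ r ≤ D
  r≤D ε 0<ε = 0 , λ k _ → begin
    r                                                ≤⟨ proj₂ (far t₀) ⟩
    _                                                ≤⟨ ∣xᵢ∣≤‖x‖∞ ((fromℚ ∘ x) -ᵛ q₀) (proj₁ (far t₀)) k ⟩
    seq D k                                          ≡⟨ ℚ.+-identityʳ _ ⟨
    seq D k ℚ.+ 0ℚ                                   ≤⟨ ℚ.+-monoʳ-≤ (seq D k) (ℚ.<⇒≤ 0<ε) ⟩
    seq D k ℚ.+ ε                                    ∎

  reassociate : ∀ a b c → (a ℚ.- b) ℚ.- c ≡ a ℚ.- (b ℚ.+ c)
  reassociate = solve 3 (λ a b c → (a :- b) :- c := a :- (b :+ c)) refl

  lower : ∀ q → q ∈ℓ ℓ → D ≤ ‖ (fromℚ ∘ x) -ᵛ q ‖∞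
  lower q (t , q≈) ε 0<ε = proj₁ close , λ k k≥ →
    -- The summand `ε` absorbs the error in `q ≈ y + t * v` at index `k`; `minimiser` is then
    -- applied to the rational parameter `seq t k`.
    let m = seq ‖ (fromℚ ∘ x) -ᵛ q ‖∞ k ℚ.+ ε
        bound : ∀ i → ℚ.∣ (x i ℚ.- y i) ℚ.- seq t k ℚ.* v i ∣ ℚ.≤ m
        bound i = begin
          ℚ.∣ (x i ℚ.- y i) ℚ.- seq t k ℚ.* v i ∣
            ≡⟨ cong ℚ.∣_∣ (reassociate (x i) (y i) (seq t k ℚ.* v i)) ⟩
          ℚ.∣ x i ℚ.- (y i ℚ.+ seq t k ℚ.* v i) ∣
            ≤⟨ triangle (x i) (seq (q i) k) (y i ℚ.+ seq t k ℚ.* v i) ⟩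
          ℚ.∣ x i ℚ.- seq (q i) k ∣ ℚ.+ ℚ.∣ seq (q i) k ℚ.- (y i ℚ.+ seq t k ℚ.* v i) ∣
            ≤⟨ ℚ.+-mono-≤ (∣xᵢ∣≤‖x‖∞ ((fromℚ ∘ x) -ᵛ q) i k) (proj₂ close k k≥ i) ⟩
          m ∎
        optimal : ∀ i → ℚ.∣ x i ℚ.- (y i ℚ.+ t₀ ℚ.* v i) ∣ ℚ.≤ m
        optimal i = subst (λ z → ℚ.∣ z ∣ ℚ.≤ m) (reassociate (x i) (y i) (t₀ ℚ.* v i))
          (proj₂ min (seq t k) m bound i)
    in ‖x‖∞≤ ((fromℚ ∘ x) -ᵛ q₀) k (ℚ.≤-trans (ℚ.0≤∣p∣ _) (optimal zero)) optimal
    where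
    close : Eventually λ k → ∀ i → ℚ.∣ seq (q i) k ℚ.- (y i ℚ.+ seq t k ℚ.* v i) ∣ ℚ.≤ ε
    close = eventually-∀ λ i → q≈ i ε 0<ε

-- Integers as rationals

ι : ℤ → ℚ
ι i = i ℚ./ 1

-- For a variable `i`, `i / 1` is stuck on normalisation; the right-hand side is a constructor form
-- on which sums and products compute.
ι≡mkℚ : ∀ i → ι i ≡ mkℚ i 0 (Coprimality.sym (1-coprimeTo ℤ.∣ i ∣))
ι≡mkℚ i = ℚ.↥p/↧p≡p (mkℚ i 0 _)

ι-+ : ∀ i j → ι (i ℤ.+ j) ≡ ι i ℚ.+ ι j
ι-+ i j = sym (trans (cong₂ ℚ._+_ (ι≡mkℚ i) (ι≡mkℚ j))
  (cong ι (cong₂ ℤ._+_ (ℤ.*-identityʳ i) (ℤ.*-identityʳ j))))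

ι-* : ∀ i j → ι (i ℤ.* j) ≡ ι i ℚ.* ι j
ι-* i j = sym (cong₂ ℚ._*_ (ι≡mkℚ i) (ι≡mkℚ j))

ι-neg : ∀ i → ι (ℤ.- i) ≡ ℚ.- ι i
ι-neg i = begin
  ι (ℤ.- i)         ≡⟨ cong ι (ℤ.-1*i≡-i i) ⟨
  ι (ℤ.-1ℤ ℤ.* i)   ≡⟨ ι-* ℤ.-1ℤ i ⟩
  ι ℤ.-1ℤ ℚ.* ι i   ≡⟨ ℚ.neg-distribˡ-* 1ℚ (ι i) ⟨
  ℚ.- (1ℚ ℚ.* ι i)  ≡⟨ cong ℚ.-_ (ℚ.*-identityˡ (ι i)) ⟩
  ℚ.- ι i           ∎
  where open ≡-Reasoning

ι-mono-≤ : ∀ {i j} → i ℤ.≤ j → ι i ℚ.≤ ι j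
ι-mono-≤ {i} {j} i≤j = subst₂ ℚ._≤_ (sym (ι≡mkℚ i)) (sym (ι≡mkℚ j))
  (ℚ.*≤* (ℤ.*-monoʳ-≤-nonNeg 1ℤ i≤j))

-- Integrality enters here: a lattice point off the line misses it by at least 1 in some coordinate
-- at its own height.
1≤∣ι∣ : ∀ i → i ≢ ℤ.0ℤ → 1ℚ ℚ.≤ ℚ.∣ ι i ∣
1≤∣ι∣ (ℤ.+ 0)      i≢0 = contradiction refl i≢0
1≤∣ι∣ ℤ.+[1+ n ]   _   = ℚ.≤-trans (ι-mono-≤ {1ℤ} {ℤ.+[1+ n ]} (ℤ.+≤+ (ℕ.s≤s ℕ.z≤n))) (p≤∣p∣ _)
1≤∣ι∣ ℤ.-[1+ n ]   _   = subst (1ℚ ℚ.≤_) (sym (ℚ.∣-p∣≡∣p∣ (ι ℤ.+[1+ n ])))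
  (1≤∣ι∣ ℤ.+[1+ n ] λ ())

ι-reciprocal : ∀ n .{{_ : NonZero n}} → ι (ℤ.+ n) ℚ.* (ℤ.+ 1 ℚ./ n) ≡ 1ℚ
ι-reciprocal (suc n) = trans
  (cong₂ ℚ._*_ (ι≡mkℚ ℤ.+[1+ n ]) (ℚ.normalize-coprime (1-coprimeTo (suc n))))
  (ℚ.*-inverseʳ (mkℚ ℤ.+[1+ n ] 0 (Coprimality.sym (1-coprimeTo (suc n)))))

-- Vectors and lists

lookup-∷ʳ-inject₁ : ∀ {A : Set} {n} (xs : Vec A n) x i → lookup (xs ∷ʳ x) (inject₁ i) ≡ lookup xs i
lookup-∷ʳ-inject₁ (y ∷ xs) x zero    = refl
lookup-∷ʳ-inject₁ (y ∷ xs) x (suc i) = lookup-∷ʳ-inject₁ xs x i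

lookup-∷ʳ-fromℕ : ∀ {A : Set} {n} (xs : Vec A n) x → lookup (xs ∷ʳ x) (Fin.fromℕ n) ≡ x
lookup-∷ʳ-fromℕ []       x = refl
lookup-∷ʳ-fromℕ (y ∷ xs) x = lookup-∷ʳ-fromℕ xs x

lookup-inject₁ : ∀ {A : Set} {n} (xs : Vec A (suc n)) i → lookup xs (inject₁ i) ≡ lookup (init xs) i
lookup-inject₁ xs i with initLast xs
... | ys , y , refl = lookup-∷ʳ-inject₁ ys y i

lookup-fromℕ : ∀ {A : Set} {n} (xs : Vec A (suc n)) → lookup xs (Fin.fromℕ n) ≡ last xs
lookup-fromℕ xs with initLast xs
... | ys , y , refl = lookup-∷ʳ-fromℕ ys y

-- Lets distinct indices of the list stand for distinct points of the set.
lookup-injective : ∀ {A : Set} {xs : List A} → Unique xs →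
  ∀ i j → List.lookup xs i ≡ List.lookup xs j → i ≡ j
lookup-injective (_    ∷ _)   zero    zero    _  = refl
lookup-injective (x∉xs ∷ _)   zero    (suc j) eq = contradiction eq (All.lookup x∉xs (∈-lookup j))
lookup-injective (x∉xs ∷ _)   (suc i) zero    eq = contradiction (sym eq) (All.lookup x∉xs (∈-lookup i))
lookup-injective (_    ∷ xs!) (suc i) (suc j) eq = cong suc (lookup-injective xs! i j eq)

-- The scaled configuration

-- μ is 1/M, and r is 1/2N, so that r + r is 1/N.
module Scaled {d : ℕ} (N M L : ℕ) (ML≤N : M ℕ.* L ℕ.≤ N)
  (μ r : ℚ) (0≤μ : 0ℚ ℚ.≤ μ) (0≤r : 0ℚ ℚ.≤ r)
  (Mμ≡1 : ι (ℤ.+ M) ℚ.* μ ≡ 1ℚ) (N[r+r]≡1 : ι (ℤ.+ N) ℚ.* (r ℚ.+ r) ≡ 1ℚ) where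

  ν : ℚ
  ν = r ℚ.+ r

  0≤ν : 0ℚ ℚ.≤ ν
  0≤ν = ℚ.+-mono-≤ 0≤r 0≤r

  scale : Vec ℚ (suc d)
  scale = replicate d ν ∷ʳ μ

  scale-fromℕ : lookup scale (Fin.fromℕ d) ≡ μ
  scale-fromℕ = lookup-∷ʳ-fromℕ (replicate d ν) μ

  scale-inject₁ : ∀ i → lookup scale (inject₁ i) ≡ ν
  scale-inject₁ i = trans (lookup-∷ʳ-inject₁ (replicate d ν) μ i) (lookup-replicate i ν)

  -- The scaling is linear, so it serves for points and direction vectors alike.
  place : Vec ℤ (suc d) → Fin (suc d) → ℚ
  place p i = lookup scale i ℚ.* ι (lookup p i)

  scale-range : ∀ {n c z} → 0ℚ ℚ.≤ c → ι (ℤ.+ n) ℚ.* c ≡ 1ℚ → z ∈[1‥ n ] →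
                0ℚ ℚ.≤ c ℚ.* ι z × c ℚ.* ι z ℚ.≤ 1ℚ
  scale-range {n} {c} {z} 0≤c nc≡1 (1≤z , z≤n) =
    subst (ℚ._≤ c ℚ.* ι z) (ℚ.*-zeroʳ c)
      (*-monoˡ-≤ 0≤c (ι-mono-≤ {ℤ.0ℤ} {z} (ℤ.≤-trans (ℤ.+≤+ ℕ.z≤n) 1≤z))) ,
    subst (c ℚ.* ι z ℚ.≤_) (trans (ℚ.*-comm c (ι (ℤ.+ n))) nc≡1)
      (*-monoˡ-≤ 0≤c (ι-mono-≤ {z} {ℤ.+ n} z≤n))

  place-in-cube : ∀ {p} → p ∈Box[ N , M ] → ∀ i → 0ℚ ℚ.≤ place p i × place p i ℚ.≤ 1ℚ
  place-in-cube {p} (front , back) i with view i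
  ... | ‵fromℕ rewrite scale-fromℕ | lookup-fromℕ p = scale-range 0≤μ Mμ≡1 back
  ... | ‵inject₁ j rewrite scale-inject₁ j | lookup-inject₁ p j =
    scale-range 0≤ν N[r+r]≡1 (lookup⁺ front j)

  -- Inserting `M * μ = 1` exchanges `∣s∣` for `M * (∣s∣ * μ)`; then `M * L ≤ N` and `N * ν = 1`
  -- remove the remaining factors.
  small-shift : ∀ s → ℚ.∣ s ∣ ℚ.* μ ℚ.≤ r → ν ℚ.* (ℚ.∣ s ∣ ℚ.* ι (ℤ.+ L)) ℚ.≤ r
  small-shift s sμ≤r = begin
    ν ℚ.* (ℚ.∣ s ∣ ℚ.* ι (ℤ.+ L))
      ≡⟨ cong (λ z → ν ℚ.* (z ℚ.* ι (ℤ.+ L))) (trans (cong (ℚ.∣ s ∣ ℚ.*_) Mμ≡1) (ℚ.*-identityʳ ℚ.∣ s ∣)) ⟨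
    ν ℚ.* (ℚ.∣ s ∣ ℚ.* (ι (ℤ.+ M) ℚ.* μ) ℚ.* ι (ℤ.+ L))
      ≡⟨ solve 5 (λ ν s M μ L → ν :* (s :* (M :* μ) :* L) := (s :* μ) :* ((M :* L) :* ν)) refl
           ν ℚ.∣ s ∣ (ι (ℤ.+ M)) μ (ι (ℤ.+ L)) ⟩
    ℚ.∣ s ∣ ℚ.* μ ℚ.* (ι (ℤ.+ M) ℚ.* ι (ℤ.+ L) ℚ.* ν)
      ≤⟨ *-monoˡ-≤ (subst (ℚ._≤ ℚ.∣ s ∣ ℚ.* μ) (ℚ.*-zeroʳ ℚ.∣ s ∣)
           (*-monoˡ-≤ (ℚ.0≤∣p∣ s) 0≤μ)) (*-monoʳ-≤ 0≤ν ML≤N′) ⟩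
    ℚ.∣ s ∣ ℚ.* μ ℚ.* (ι (ℤ.+ N) ℚ.* ν)
      ≡⟨ trans (cong (ℚ.∣ s ∣ ℚ.* μ ℚ.*_) N[r+r]≡1) (ℚ.*-identityʳ (ℚ.∣ s ∣ ℚ.* μ)) ⟩
    ℚ.∣ s ∣ ℚ.* μ
      ≤⟨ sμ≤r ⟩
    r ∎
    where
    open ℚ.≤-Reasoning
    ML≤N′ : ι (ℤ.+ M) ℚ.* ι (ℤ.+ L) ℚ.≤ ι (ℤ.+ N)
    ML≤N′ = subst (ℚ._≤ ι (ℤ.+ N))
      (trans (cong ι (ℤ.pos-* M L)) (ι-* (ℤ.+ M) (ℤ.+ L)))
      (ι-mono-≤ {ℤ.+ (M ℕ.* L)} {ℤ.+ N} (ℤ.+≤+ ML≤N))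

  -- Reverse triangle inequality: `ν ≤ ν * ∣w∣ ≤ r + ν * ∣x∣`, and `ν - r = r`.
  far-coordinate : ∀ w s v → 1ℚ ℚ.≤ ℚ.∣ w ∣ → ℚ.∣ v ∣ ℚ.≤ ι (ℤ.+ L) → ℚ.∣ s ∣ ℚ.* μ ℚ.≤ r →
                   r ℚ.≤ ℚ.∣ ν ℚ.* (w ℚ.- s ℚ.* v) ∣
  far-coordinate w s v 1≤∣w∣ ∣v∣≤L sμ≤r =
    subst₂ ℚ._≤_ (solve 1 (λ r → (r :+ r) :- r := r) refl r) (sym ∣νx∣)
      (p≤q+e⇒p-q≤e ν r ν≤r+νx)
    where
    open ℚ.≤-Reasoning
    x : ℚ
    x = w ℚ.- s ℚ.* v

    ∣νx∣ : ℚ.∣ ν ℚ.* x ∣ ≡ ν ℚ.* ℚ.∣ x ∣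
    ∣νx∣ = trans (ℚ.∣p*q∣≡∣p∣*∣q∣ ν x) (cong (ℚ._* ℚ.∣ x ∣) (ℚ.0≤p⇒∣p∣≡p 0≤ν))

    ν≤r+νx : ν ℚ.≤ r ℚ.+ ν ℚ.* ℚ.∣ x ∣
    ν≤r+νx = begin
      ν
        ≡⟨ ℚ.*-identityʳ ν ⟨
      ν ℚ.* 1ℚ
        ≤⟨ *-monoˡ-≤ 0≤ν 1≤∣w∣ ⟩
      ν ℚ.* ℚ.∣ w ∣
        ≡⟨ cong (λ z → ν ℚ.* ℚ.∣ z ∣) (solve 2 (λ w y → w := y :+ (w :- y)) refl w (s ℚ.* v)) ⟩
      ν ℚ.* ℚ.∣ s ℚ.* v ℚ.+ x ∣
        ≤⟨ *-monoˡ-≤ 0≤ν (ℚ.∣p+q∣≤∣p∣+∣q∣ (s ℚ.* v) x) ⟩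
      ν ℚ.* (ℚ.∣ s ℚ.* v ∣ ℚ.+ ℚ.∣ x ∣)
        ≡⟨ cong (λ z → ν ℚ.* (z ℚ.+ ℚ.∣ x ∣)) (ℚ.∣p*q∣≡∣p∣*∣q∣ s v) ⟩
      ν ℚ.* (ℚ.∣ s ∣ ℚ.* ℚ.∣ v ∣ ℚ.+ ℚ.∣ x ∣)
        ≡⟨ ℚ.*-distribˡ-+ ν (ℚ.∣ s ∣ ℚ.* ℚ.∣ v ∣) ℚ.∣ x ∣ ⟩
      ν ℚ.* (ℚ.∣ s ∣ ℚ.* ℚ.∣ v ∣) ℚ.+ ν ℚ.* ℚ.∣ x ∣
        ≤⟨ ℚ.+-monoˡ-≤ (ν ℚ.* ℚ.∣ x ∣) (ℚ.≤-trans
             (*-monoˡ-≤ 0≤ν (*-monoˡ-≤ (ℚ.0≤∣p∣ s) ∣v∣≤L)) (small-shift s sμ≤r)) ⟩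
      r ℚ.+ ν ℚ.* ℚ.∣ x ∣ ∎

  -- The position of `p′` relative to the point with parameter `t` on the line through `p`

  module _ (p p′ : Vec ℤ (suc d)) (u : Vec ℤ d)
    (∣u∣≤L : ∀ i → ℚ.∣ ι (lookup u i) ∣ ℚ.≤ ι (ℤ.+ L))
    (off : ¬ (∃[ k ] ∀ i → lookup p′ i ≡ lookup p i ℤ.+ k ℤ.* lookup (u ∷ʳ 1ℤ) i))
    (t : ℚ) where

    v : Vec ℤ (suc d)
    v = u ∷ʳ 1ℤ

    k : ℤ
    k = last p′ ℤ.- last p

    s : ℚ
    s = t ℚ.- ι k

    -- The lattice point at which the line through `p` reaches the height of `p′`.
    slice : Fin (suc d) → ℤ
    slice i = lookup p i ℤ.+ k ℤ.* lookup v i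

    offset : Fin (suc d) → ℤ
    offset i = lookup p′ i ℤ.- slice i

    slice-fromℕ : lookup p′ (Fin.fromℕ d) ≡ slice (Fin.fromℕ d)
    slice-fromℕ rewrite lookup-fromℕ p | lookup-fromℕ p′ | lookup-∷ʳ-fromℕ u 1ℤ = begin
      last p′                              ≡⟨ ℤ.+-identityˡ (last p′) ⟨
      ℤ.0ℤ ℤ.+ last p′                     ≡⟨ cong (ℤ._+ last p′) (ℤ.+-inverseʳ (last p)) ⟨
      last p ℤ.- last p ℤ.+ last p′        ≡⟨ ℤ.+-assoc (last p) (ℤ.- last p) (last p′) ⟩
      last p ℤ.+ (ℤ.- last p ℤ.+ last p′)  ≡⟨ cong (ℤ._+_ (last p)) (ℤ.+-comm (ℤ.- last p) (last p′)) ⟩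
      last p ℤ.+ k                         ≡⟨ cong (ℤ._+_ (last p)) (ℤ.*-identityʳ k) ⟨
      last p ℤ.+ k ℤ.* 1ℤ                  ∎
      where open ≡-Reasoning

    -- Writing `t` as `k + s` splits off the lattice point `slice`, and the scaling factor comes out
    -- by linearity.
    displacement : ∀ i → place p′ i ℚ.- (place p i ℚ.+ t ℚ.* place v i) ≡
                         lookup scale i ℚ.* (ι (offset i) ℚ.- s ℚ.* ι (lookup v i))
    displacement i = begin
      place p′ i ℚ.- (place p i ℚ.+ t ℚ.* place v i)
        ≡⟨ solve 6 (λ c x′ x t y k → c :* x′ :- (c :* x :+ t :* (c :* y)) :=
                                     c :* ((x′ :- (x :+ k :* y)) :- (t :- k) :* y)) refl
             (lookup scale i) (ι (lookup p′ i)) (ι (lookup p i)) t (ι (lookup v i)) (ι k) ⟩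
      lookup scale i ℚ.* ((ι (lookup p′ i) ℚ.- (ι (lookup p i) ℚ.+ ι k ℚ.* ι (lookup v i)))
                            ℚ.- s ℚ.* ι (lookup v i))
        ≡⟨ cong (λ z → lookup scale i ℚ.* (z ℚ.- s ℚ.* ι (lookup v i))) ι-offset ⟨
      lookup scale i ℚ.* (ι (offset i) ℚ.- s ℚ.* ι (lookup v i)) ∎
      where
      open ≡-Reasoning
      ι-offset : ι (offset i) ≡ ι (lookup p′ i) ℚ.- (ι (lookup p i) ℚ.+ ι k ℚ.* ι (lookup v i))
      ι-offset = trans (ι-+ (lookup p′ i) (ℤ.- slice i))
        (cong (ι (lookup p′ i) ℚ.+_) (trans (ι-neg (slice i))
          (cong ℚ.-_ (trans (ι-+ (lookup p i) (k ℤ.* lookup v i))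
            (cong (ι (lookup p i) ℚ.+_) (ι-* k (lookup v i)))))))

    gap : Fin (suc d) → ℚ
    gap i = ℚ.∣ lookup scale i ℚ.* (ι (offset i) ℚ.- s ℚ.* ι (lookup v i)) ∣

    -- In the last coordinate the offset vanishes and the direction is 1, which leaves only the
    -- shift `s`.
    gap-fromℕ : gap (Fin.fromℕ d) ≡ ℚ.∣ s ∣ ℚ.* μ
    gap-fromℕ = begin
      gap (Fin.fromℕ d)
        ≡⟨ cong ℚ.∣_∣ (cong₂ ℚ._*_ scale-fromℕ (cong₂ (λ w y → ι w ℚ.- s ℚ.* ι y)
             (ℤ.i≡j⇒i-j≡0 slice-fromℕ) (lookup-∷ʳ-fromℕ u 1ℤ))) ⟩
      ℚ.∣ μ ℚ.* (0ℚ ℚ.- s ℚ.* 1ℚ) ∣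
        ≡⟨ cong (λ z → ℚ.∣ μ ℚ.* z ∣) (trans (ℚ.+-identityˡ (ℚ.- (s ℚ.* 1ℚ))) (cong ℚ.-_ (ℚ.*-identityʳ s))) ⟩
      ℚ.∣ μ ℚ.* ℚ.- s ∣
        ≡⟨ ℚ.∣p*q∣≡∣p∣*∣q∣ μ (ℚ.- s) ⟩
      ℚ.∣ μ ∣ ℚ.* ℚ.∣ ℚ.- s ∣
        ≡⟨ cong₂ ℚ._*_ (ℚ.0≤p⇒∣p∣≡p 0≤μ) (ℚ.∣-p∣≡∣p∣ s) ⟩
      μ ℚ.* ℚ.∣ s ∣
        ≡⟨ ℚ.*-comm μ ℚ.∣ s ∣ ⟩
      ℚ.∣ s ∣ ℚ.* μ ∎
      where open ≡-Reasoning

    large-gap : ∃[ i ] r ℚ.≤ gap i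
    large-gap with r ℚ.≤? ℚ.∣ s ∣ ℚ.* μ
    ... | yes r≤sμ = Fin.fromℕ d , subst (r ℚ.≤_) (sym gap-fromℕ) r≤sμ
    -- Equality of integers is decidable, so `p′` differing from `slice` yields an explicit
    -- coordinate.
    ... | no  r≰sμ with ¬∀⟶∃¬ (suc d) _ (λ i → lookup p′ i ℤ.≟ slice i) (λ on → off (k , on))
    ...   | i , i-off with view i
    -- Both points have the same height, so the differing coordinate is among the first `d`.
    ...     | ‵fromℕ     = contradiction slice-fromℕ i-off
    ...     | ‵inject₁ j = inject₁ j , subst
      (λ c → r ℚ.≤ ℚ.∣ c ℚ.* (ι (offset (inject₁ j)) ℚ.- s ℚ.* ι (lookup v (inject₁ j))) ∣)
      (sym (scale-inject₁ j))
      (far-coordinate (ι (offset (inject₁ j))) s (ι (lookup v (inject₁ j)))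
        (1≤∣ι∣ (offset (inject₁ j)) (i-off ∘ ℤ.i-j≡0⇒i≡j _ _))
        (subst (λ y → ℚ.∣ ι y ∣ ℚ.≤ ι (ℤ.+ L)) (sym (lookup-∷ʳ-inject₁ u 1ℤ j)) (∣u∣≤L j))
        (ℚ.<⇒≤ (ℚ.≰⇒> r≰sμ)))

    far : ∃[ i ] r ℚ.≤ ℚ.∣ place p′ i ℚ.- (place p i ℚ.+ t ℚ.* place v i) ∣
    far with large-gap
    ... | i , r≤gap = i , subst (λ z → r ℚ.≤ ℚ.∣ z ∣) (sym (displacement i)) r≤gap

-- Transfer of the rational configuration to real points and lines

theorem1p15 : (d N M L : ℕ)
    .{{_ : NonZero d}} .{{_ : NonZero N}} .{{_ : NonZero M}} .{{_ : NonZero L}} →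
    M ℕ.* L ℕ.≤ N →
    -- the finite set P, listed without repetition, so that |P| = length P
    (P : List (Vec ℤ (suc d))) → Unique P →
    (∀ {p} → p ∈ P → p ∈Box[ N , M ]) →
    -- only the values of u at points of P matter
    (u : Vec ℤ (suc d) → Vec ℤ d) →
    (∀ {p} → p ∈ P → ‖ ⟦ u p ⟧ ‖∞ ≤ fromℕ L) →
    (∀ {p p′} → p ∈ P → p′ ∈ P → p ≢ p′ → ¬ (⟦ p′ ⟧ ∈ ⟦ p ⟧ +ℝ ⟦ u p ∷ʳ 1ℤ ⟧)) →
    Σ[ pt ∈ (Fin (length P) → ℝ^ (suc d)) ]
    Σ[ ℓ ∈ (Fin (length P) → Line (suc d)) ]
    (∀ i → InUnitCube (pt i)) ×
    (∀ i → pt i ∈ℓ ℓ i) ×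
    (∀ i j → i ≢ j → dist∞ (pt i) to ℓ j ≥ 1/[2* N ])
theorem1p15 d N M L ML≤N P P! P⊆box u ∣u∣≤L off =
  pt , ℓ , in-cube , on-line , separated
  where
  2N≢0 : NonZero (2 ℕ.* N)
  2N≢0 = ℕ.m*n≢0 2 N

  μ r : ℚ
  μ = ℤ.+ 1 ℚ./ M
  r = (ℤ.+ 1 ℚ./ (2 ℕ.* N)) {{2N≢0}}

  0<μ : 0ℚ ℚ.< μ
  0<μ = ℚ.positive⁻¹ μ {{ℚ.normalize-pos 1 M}}

  0<r : 0ℚ ℚ.< r
  0<r = ℚ.positive⁻¹ r {{ℚ.normalize-pos 1 (2 ℕ.* N) {{2N≢0}}}}

  N[r+r]≡1 : ι (ℤ.+ N) ℚ.* (r ℚ.+ r) ≡ 1ℚ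
  N[r+r]≡1 = begin
    ι (ℤ.+ N) ℚ.* (r ℚ.+ r)         ≡⟨ ℚ.*-distribˡ-+ (ι (ℤ.+ N)) r r ⟩
    ι (ℤ.+ N) ℚ.* r ℚ.+ ι (ℤ.+ N) ℚ.* r   ≡⟨ ℚ.*-distribʳ-+ r (ι (ℤ.+ N)) (ι (ℤ.+ N)) ⟨
    (ι (ℤ.+ N) ℚ.+ ι (ℤ.+ N)) ℚ.* r ≡⟨ cong (ℚ._* r) (ι-+ (ℤ.+ N) (ℤ.+ N)) ⟨
    ι (ℤ.+ (N ℕ.+ N)) ℚ.* r         ≡⟨ cong (λ n → ι (ℤ.+ (N ℕ.+ n)) ℚ.* r) (ℕ.+-identityʳ N) ⟨
    ι (ℤ.+ (2 ℕ.* N)) ℚ.* r         ≡⟨ ι-reciprocal (2 ℕ.* N) {{2N≢0}} ⟩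
    1ℚ                              ∎
    where open ≡-Reasoning

  open Scaled {d} N M L ML≤N μ r (ℚ.<⇒≤ 0<μ) (ℚ.<⇒≤ 0<r) (ι-reciprocal M) N[r+r]≡1

  point : Fin (length P) → Vec ℤ (suc d)
  point = List.lookup P

  point∈P : ∀ i → point i ∈ P
  point∈P = ∈-lookup

  dir : Fin (length P) → Vec ℤ (suc d)
  dir i = u (point i) ∷ʳ 1ℤ

  pt : Fin (length P) → ℝ^ (suc d)
  pt i = fromℚ ∘ place (point i)

  dir-fromℕ : ∀ i → place (dir i) (Fin.fromℕ d) ≡ μ
  dir-fromℕ i = trans (cong₂ (λ c y → c ℚ.* ι y) scale-fromℕ (lookup-∷ʳ-fromℕ (u (point i)) 1ℤ))
    (ℚ.*-identityʳ μ)

  ℓ : Fin (length P) → Line (suc d)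
  ℓ i = record
    { base      = pt i
    ; direction = fromℚ ∘ place (dir i)
    -- The last coordinate of the scaled direction is `μ > 0`, so `μ` itself witnesses apartness
    -- from 0.
    ; nonzero   = Fin.fromℕ d , μ , 0<μ , 0 , λ _ _ →
        subst (ℚ._≤ ℚ.∣ place (dir i) (Fin.fromℕ d) ∣)
          (trans (dir-fromℕ i) (sym (ℚ.+-identityˡ μ))) (p≤∣p∣ _)
    }

  fromℚ-mono : ∀ {p q} → p ℚ.≤ q → fromℚ p ≤ fromℚ q
  fromℚ-mono {p} {q} p≤q ε 0<ε = 0 , λ _ _ →
    subst (ℚ._≤ q ℚ.+ ε) (ℚ.+-identityʳ p) (ℚ.+-mono-≤ p≤q (ℚ.<⇒≤ 0<ε))

  in-cube : ∀ i → InUnitCube (pt i)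
  in-cube i c with place-in-cube (P⊆box (point∈P i)) c
  ... | 0≤x , x≤1 = fromℚ-mono 0≤x , fromℚ-mono x≤1

  on-line : ∀ i → pt i ∈ℓ ℓ i
  on-line i = 0ℝ , λ c ε 0<ε → 0 , λ n _ →
    subst (λ z → ℚ.∣ place (point i) c ℚ.- z ∣ ℚ.≤ ε) (0v i c) (proj₂ (≈-refl (pt i c) ε 0<ε) n ℕ.z≤n)
    where
    0v : ∀ i c → place (point i) c ≡ place (point i) c ℚ.+ 0ℚ ℚ.* place (dir i) c
    0v i c = sym (trans (cong (place (point i) c ℚ.+_) (ℚ.*-zeroˡ (place (dir i) c)))
                        (ℚ.+-identityʳ (place (point i) c)))

  -- The hypothesis compares constant sequences up to every `ε`; one term per `ε` suffices, and
  -- `≤-approx` removes `ε`.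
  ∣uᵢ∣≤L : ∀ i c → ℚ.∣ ι (lookup (u (point i)) c) ∣ ℚ.≤ ι (ℤ.+ L)
  ∣uᵢ∣≤L i c = ≤-approx λ ε 0<ε →
    let k , h = ∣u∣≤L (point∈P i) ε 0<ε
    in ℚ.≤-trans (∣xᵢ∣≤‖x‖∞ ⟦ u (point i) ⟧ c k) (h k ℕ.≤-refl)

  -- An integer parameter is also a real one, so `off` yields the integer form of the condition that
  -- `far` takes.
  lattice-line : ∀ i j → (∃[ k ] ∀ c → lookup (point i) c ≡ lookup (point j) c ℤ.+ k ℤ.* lookup (dir j) c) →
                 ⟦ point i ⟧ ∈ ⟦ point j ⟧ +ℝ ⟦ dir j ⟧
  lattice-line i j (k , on) = fromℤ k , λ c ε 0<ε → 0 , λ n _ →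
    subst (λ z → ℚ.∣ ι (lookup (point i) c) ℚ.- z ∣ ℚ.≤ ε)
      (trans (cong ι (on c)) (trans (ι-+ (lookup (point j) c) (k ℤ.* lookup (dir j) c))
        (cong (ι (lookup (point j) c) ℚ.+_) (ι-* k (lookup (dir j) c)))))
      (proj₂ (≈-refl (⟦ point i ⟧ c) ε 0<ε) n ℕ.z≤n)

  separated : ∀ i j → i ≢ j → dist∞ (pt i) to ℓ j ≥ 1/[2* N ]
  separated i j i≢j = dist-to-rational-line (place (point i)) (ℓ j) (place (point j)) (place (dir j))
    refl refl
    (Fin.fromℕ d , λ v≡0 → ℚ.<⇒≢ 0<μ (trans (sym v≡0) (dir-fromℕ j)))
    -- The line belongs to `j` and the point to `i`, so `j` comes first and the inequality of
    -- indices is reversed.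
    r (far (point j) (point i) (u (point j)) (∣uᵢ∣≤L j)
      (off (point∈P j) (point∈P i) (λ eq → i≢j (sym (lookup-injective P! j i eq))) ∘ lattice-line i j))
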